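{- $\langle\forall^\infty\exists^\infty\rangle\not\le_{\sf m}\langle\forall^\infty\exists\rangle$.
   Context: Quantifiers range over $\omega$. $\exists^\infty n\,\varphi(n)$ means $\forall m\exists n\ge m\,\varphi(n)$ and $\forall^\infty n\,\varphi(n)$ means $\exists m\forall n\ge m\,\varphi(n)$. A quantifier-pattern is a finite string $\bar{\mathsf Q}=\mathsf Q_0\dots\mathsf Q_\ell$ over $\{\exists,\forall,\exists^\infty,\forall^\infty\}$. A $\bar{\mathsf Q}$-formula is $\varphi(\bar x)\equiv\mathsf Q_0n_0\dots\mathsf Q_\ell n_\ell\,\theta(n_0,\dots,n_\ell,\bar x)$ with $\theta$ bounded. The instance $\bar x$ is a tuple of natural numbers and/or total computable functions (computable elements of $\omega^\omega$). Spaces such as $\omega\times\omega^\omega$, $(\omega^\omega)^\omega$, $\omega^{\omega\times\omega}$ are identified with $\omega^\omega$ by computable pairing. Witnesses: for $\alpha\in\omega^\omega$, $\alpha\Vdash\varphi(\bar x)$ ("$\alpha$ is a witness for $\varphi(\bar x)$") is defined by: $\alpha\Vdash\theta(\bar x)$ iff $\alpha=\bar x$ and $\theta(\bar x)$, for bounded $\theta$; $\langle t,\alpha\rangle\Vdash\exists n\varphi(n,\bar x)$ iff $\alpha\Vdash\varphi(t,\bar x)$; $\alpha\Vdash\forall n\varphi(n,\bar x)$ iff $\alpha(n)\Vdash\varphi(n,\bar x)$ for all $n$; $\langle t,\alpha\rangle\Vdash\forall^\infty n\varphi(n,\bar x)$ iff $\alpha(n)\Vdash\varphi(n,\bar x)$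 for all $n\ge t$; $\alpha\Vdash\exists^\infty n\varphi(n,\bar x)$ iff for all $n$, writing $\alpha(n)=\langle k,\beta\rangle$, $k\ge n$ and $\beta\Vdash\varphi(k,\bar x)$. $\varphi\le_{\sf m}\psi$ if there are computable functions $\eta,r_-,r_+$ (type-two computable functionals, possibly partial but defined wherever required) such that for every instance $\bar x$: $\varphi(\bar x)$ is true iff $\psi(\eta(\bar x))$ is true; $\alpha\Vdash\varphi(\bar x)$ implies $r_-(\alpha,\bar x)\Vdash\psi(\eta(\bar x))$; $\alpha\Vdash\psi(\eta(\bar x))$ implies $r_+(\alpha,\bar x)\Vdash\varphi(\bar x)$ ($\alpha\in\omega^\omega$ arbitrary). $\langle\bar{\mathsf Q}\rangle$ denotes a fixed $\bar{\mathsf Q}$-formula to which every $\bar{\mathsf Q}$-formula is $\le_{\sf m}$-reducible; concretely $\langle\bar{\mathsf Q}\rangle(x)\equiv\mathsf Q_0n_0\dots\mathsf Q_\ell n_\ell.\ x(n_0,\dots,n_\ell)=0$ (the choice does not matter up to $\equiv_{\sf m}$). -}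

module Defs where

open import Data.Fin using (Fin)
open import Data.Nat using (ℕ; zero; suc; _*_; _≤_; _<_)
open import Data.Product using (Σ-syntax; ∃-syntax; _×_; _,_)
open import Data.Vec using (Vec; []; _∷_; lookup; foldr)
open import Data.Vec.Relation.Binary.Pointwise.Inductive using (Pointwise)
open import Function using (_∘_; _⇔_)
open import Relation.Binary.PropositionalEquality using (_≡_; _≗_)

Baire : Set
Baire = ℕ → ℕ

-- Partial recursive functions of k natural numbers relative to o oracles.

data Code (o : ℕ) : ℕ → Set where
  zeroᶜ   : ∀ {k} → Code o k
  sucᶜ    : Code o 1
  proj    : ∀ {k} → Fin k → Code o k
  query   : Fin o → Code o 1
  comp    : ∀ {j k} → Code o j → Vec (Code o k) j → Code o k
  primrec : ∀ {k} → Code o k → Code o (suc (suc k)) → Code o (suc k)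
  μ       : ∀ {k} → Code o (suc k) → Code o k

infix 4 _⊢_·_⇓_

-- ρ ⊢ e · ns ⇓ v : with oracles ρ, program e halts on input ns with output v.

data _⊢_·_⇓_ {o : ℕ} (ρ : Vec Baire o) : ∀ {k} → Code o k → Vec ℕ k → ℕ → Set where
  zero⇓  : ∀ {k} {ns : Vec ℕ k} → ρ ⊢ zeroᶜ · ns ⇓ 0
  suc⇓   : ∀ {n} → ρ ⊢ sucᶜ · n ∷ [] ⇓ suc n
  proj⇓  : ∀ {k} {i : Fin k} {ns} → ρ ⊢ proj i · ns ⇓ lookup ns i
  query⇓ : ∀ {i : Fin o} {n} → ρ ⊢ query i · n ∷ [] ⇓ lookup ρ i n
  comp⇓  : ∀ {j k} {f : Code o j} {gs : Vec (Code o k) j} {ns ms v} →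
           Pointwise (λ g m → ρ ⊢ g · ns ⇓ m) gs ms →
           ρ ⊢ f · ms ⇓ v →
           ρ ⊢ comp f gs · ns ⇓ v
  base⇓  : ∀ {k} {f : Code o k} {g ns v} →
           ρ ⊢ f · ns ⇓ v →
           ρ ⊢ primrec f g · 0 ∷ ns ⇓ v
  step⇓  : ∀ {k} {f : Code o k} {g n ns u v} →
           ρ ⊢ primrec f g · n ∷ ns ⇓ u →
           ρ ⊢ g · n ∷ u ∷ ns ⇓ v →
           ρ ⊢ primrec f g · suc n ∷ ns ⇓ v
  μ⇓     : ∀ {k} {f : Code o (suc k)} {ns n} →
           (∀ m → m < n → ∃[ v ] ρ ⊢ f · m ∷ ns ⇓ suc v) →
           ρ ⊢ f · n ∷ ns ⇓ 0 →
           ρ ⊢ μ f · ns ⇓ n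

-- A code in Code o 1 denotes a partial type-two functional of o arguments:
-- e ⟪ ρ ⟫≃ β says that its value at ρ is defined (as a total function) and is β.

_⟪_⟫≃_ : ∀ {o} → Code o 1 → Vec Baire o → Baire → Set
e ⟪ ρ ⟫≃ β = ∀ n → ρ ⊢ e · n ∷ [] ⇓ β n

Computable : Baire → Set
Computable x = Σ[ e ∈ Code 0 1 ] e ⟪ [] ⟫≃ x

-- The identification of ω × ω^ω with ω^ω: ⟨t,α⟩ is t ∷ˢ α.

infixr 5 _∷ˢ_

_∷ˢ_ : ℕ → Baire → Baire
(t ∷ˢ α) zero    = t
(t ∷ˢ α) (suc n) = α n

head : Baire → ℕ
head α = α 0

tail : Baire → Baire
tail α = α ∘ suc

-- The bijection (n , m) ↦ 2ⁿ(2m+1) ∸ 1 from ω × ω to ω.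

pair : ℕ → ℕ → ℕ
pair zero    m = 2 * m
pair (suc n) m = suc (2 * pair n m)

-- The identification of ω^ω with (ω^ω)^ω: section α n is α(n).

section : Baire → ℕ → Baire
section α n m = α (pair n m)

tuple : ∀ {ℓ} → Vec ℕ (suc ℓ) → ℕ
tuple (n ∷ [])         = n
tuple (n ∷ ns@(_ ∷ _)) = pair n (tuple ns)

data Quantifier : Set where
  ∃′ ∀′ ∃∞ ∀∞ : Quantifier

-- The pattern Q₀…Q_ℓ has length suc ℓ.  An instance is a single element of
-- Baire, tuples being coded as above.  Boundedness of the matrix is not imposed:
-- truth, witnesses and reducibility make sense for every matrix.

record Formula : Set₁ where
  field
    {ℓ}    : ℕ
    prefix : Vec Quantifier (suc ℓ)
    matrix : Vec ℕ (suc ℓ) → Baire → Set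

open Formula

⟦_⟧ : Quantifier → (ℕ → Set) → Set
⟦ ∃′ ⟧ P = ∃[ n ] P n
⟦ ∀′ ⟧ P = ∀ n → P n
⟦ ∃∞ ⟧ P = ∀ m → ∃[ n ] m ≤ n × P n
⟦ ∀∞ ⟧ P = ∃[ m ] ∀ n → m ≤ n → P n

Holds : ∀ {k} → Vec Quantifier k → (Vec ℕ k → Set) → Set
Holds []      θ = θ []
Holds (q ∷ Q) θ = ⟦ q ⟧ λ n → Holds Q λ ns → θ (n ∷ ns)

True : Formula → Baire → Set
True φ x = Holds (prefix φ) λ ns → matrix φ ns x

-- One clause of the definition of witnesses: W n β says that β is a witness for
-- the formula with the outermost quantified variable instantiated to n.

⟦_⟧ʷ : Quantifier → (ℕ → Baire → Set) → Baire → Set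
⟦ ∃′ ⟧ʷ W α = W (head α) (tail α)
⟦ ∀′ ⟧ʷ W α = ∀ n → W n (section α n)
⟦ ∃∞ ⟧ʷ W α = ∀ n → n ≤ head (section α n) × W (head (section α n)) (tail (section α n))
⟦ ∀∞ ⟧ʷ W α = ∀ n → head α ≤ n → W n (section (tail α) n)

Witness : ∀ {k} → Vec Quantifier k → (Vec ℕ k → Baire → Set) → Baire → Set
Witness []      W = W []
Witness (q ∷ Q) W = ⟦ q ⟧ʷ λ n → Witness Q λ ns → W (n ∷ ns)

infixr 5 _++ˢ_

_++ˢ_ : ∀ {k} → Vec ℕ k → Baire → Baire
ns ++ˢ x = foldr (λ _ → Baire) _∷ˢ_ x ns

infix 4 _⊩_at_

-- At the leaves the instance of the matrix is the whole tuple (n₀,…,n_ℓ,x), so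
-- this tuple is what the witness has to equal there.

_⊩_at_ : Baire → Formula → Baire → Set
α ⊩ φ at x = Witness (prefix φ) (λ ns β → β ≗ ns ++ˢ x × matrix φ ns x) α

infix 4 _≤ₘ_

record _≤ₘ_ (φ ψ : Formula) : Set where
  field
    η        : Code 1 1
    r₋ r₊    : Code 2 1
    reduces  : ∀ x → Computable x → ∃[ y ]
                 η ⟪ x ∷ [] ⟫≃ y
               × (True φ x ⇔ True ψ y)
               × (∀ α → α ⊩ φ at x → ∃[ β ] r₋ ⟪ α ∷ x ∷ [] ⟫≃ β × β ⊩ ψ at y)
               × (∀ α → α ⊩ ψ at y → ∃[ β ] r₊ ⟪ α ∷ x ∷ [] ⟫≃ β × β ⊩ φ at x)

⟨_⟩ : ∀ {ℓ} → Vec Quantifier (suc ℓ) → Formula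
⟨ Q ⟩ = record { prefix = Q ; matrix = λ ns x → x (tuple ns) ≡ 0 }

{-# OPTIONS --safe #-}
-- Computable functionals are continuous, and the argument uses nothing else about them.
-- From x₀ = 0 with a φ-witness starting at 0, r₋ produces a ψ-witness with starting
-- point s₀, and r₊ turns it into a φ-witness with starting point t₀; both numbers depend
-- only on finite prefixes.  Let x₁ extend the prefix of x₀ with columns ≤ t₀ eventually
-- nonzero and columns > t₀ zero; a φ-witness starting at t₀ + 1 yields some s₁.  Let x₂
-- extend the prefix of x₁ on which s₁ depends by zeros.  It has a φ-witness starting at
-- 0, so all n ≥ s₀ are good for η(x₂), and for the finitely many n in [s₀ , s₁) a prefix
-- of x₂ suffices.  Finally x₃ extends this prefix with columns ≤ t₀ eventually nonzero.
-- It still yields s₁, so n ≥ s₁ are good for η(x₃), and so are those in [s₀ , s₁).  Hence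
-- η(x₃) has a ψ-witness starting at s₀ and close to the original one, which r₊ maps to a
-- φ-witness starting at t₀, although column t₀ of x₃ has only finitely many zeros.

module Submission where

open import Data.Empty using (⊥)
open import Data.Fin using (zero; suc)
open import Data.Nat using (ℕ; zero; suc; _+_; _*_; _⊔_; _≤_; _<_; z≤n; s≤s; _<?_)
open import Data.Nat.Induction using (<-rec)
open import Data.Nat.Properties
open import Data.Product using (∃-syntax; _×_; _,_; proj₁; proj₂)
open import Data.Sum using (_⊎_; inj₁; inj₂)
open import Data.Vec using (Vec; []; _∷_; lookup)
open import Data.Vec.Relation.Binary.Pointwise.Inductive using (Pointwise; []; _∷_)
open import Function using (_∘_)
open import Relation.Binary.PropositionalEquality using (_≡_; _≢_; _≗_; refl; sym; trans; cong; cong₂; subst; module ≡-Reasoning)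
open import Relation.Binary.Definitions using (tri<; tri≈; tri>)
open import Relation.Nullary using (¬_; yes; no; contradiction)
open import Defs

-- Agreement on finite prefixes

Agree : ℕ → Baire → Baire → Set
Agree U f g = ∀ p → p < U → f p ≡ g p

Agree-mono : ∀ {U V f g} → U ≤ V → Agree V f g → Agree U f g
Agree-mono U≤V a p p<U = a p (<-≤-trans p<U U≤V)

Agree-sym : ∀ {U f g} → Agree U f g → Agree U g f
Agree-sym a p p<U = sym (a p p<U)

Agree-trans : ∀ {U f g h} → Agree U f g → Agree U g h → Agree U f h
Agree-trans a b p p<U = trans (a p p<U) (b p p<U)

AgreeVec : ∀ {o} → ℕ → Vec Baire o → Vec Baire o → Set
AgreeVec U = Pointwise (Agree U)

AgreeVec-mono : ∀ {o U V} {ρ σ : Vec Baire o} → U ≤ V → AgreeVec V ρ σ → AgreeVec U ρ σ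
AgreeVec-mono U≤V []       = []
AgreeVec-mono U≤V (a ∷ as) = Agree-mono U≤V a ∷ AgreeVec-mono U≤V as

AgreeVec-lookup : ∀ {o U} {ρ σ : Vec Baire o} → AgreeVec U ρ σ → ∀ i → Agree U (lookup ρ i) (lookup σ i)
AgreeVec-lookup (a ∷ as) zero    = a
AgreeVec-lookup (a ∷ as) (suc i) = AgreeVec-lookup as i

uniform-bound : (P : ℕ → ℕ → Set) → (∀ {n U V} → U ≤ V → P n U → P n V) →
                ∀ N → (∀ n → n < N → ∃[ U ] P n U) → ∃[ U ] ∀ n → n < N → P n U
uniform-bound P mono zero    h = 0 , λ _ ()
uniform-bound P mono (suc N) h =
  let U , hU = uniform-bound P mono N (λ n n<N → h n (m<n⇒m<1+n n<N))
      V , hV = h N ≤-refl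
  in U ⊔ V , λ n n<1+N → case-≤ U V hU hV (m<1+n⇒m<n∨m≡n n<1+N)
  where
  case-≤ : ∀ U V → (∀ n → n < N → P n U) → P N V → ∀ {n} → n < N ⊎ n ≡ N → P n (U ⊔ V)
  case-≤ U V hU hV (inj₁ n<N)  = mono (m≤m⊔n U V) (hU _ n<N)
  case-≤ U V hU hV (inj₂ refl) = mono (m≤n⊔m U V) hV

-- Oracle computations

⇓-deterministic : ∀ {o k} {ρ : Vec Baire o} {e : Code o k} {ns u v} →
                  ρ ⊢ e · ns ⇓ u → ρ ⊢ e · ns ⇓ v → u ≡ v
⇓*-deterministic : ∀ {o j k} {ρ : Vec Baire o} {gs : Vec (Code o k) j} {ns us vs} →
                   Pointwise (λ g m → ρ ⊢ g · ns ⇓ m) gs us →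
                   Pointwise (λ g m → ρ ⊢ g · ns ⇓ m) gs vs → us ≡ vs
⇓-deterministic zero⇓ zero⇓ = refl
⇓-deterministic suc⇓ suc⇓ = refl
⇓-deterministic proj⇓ proj⇓ = refl
⇓-deterministic query⇓ query⇓ = refl
⇓-deterministic (comp⇓ ds d) (comp⇓ ds′ d′) with refl ← ⇓*-deterministic ds ds′ = ⇓-deterministic d d′
⇓-deterministic (base⇓ d) (base⇓ d′) = ⇓-deterministic d d′
⇓-deterministic (step⇓ c d) (step⇓ c′ d′) with refl ← ⇓-deterministic c c′ = ⇓-deterministic d d′
⇓-deterministic {u = m} {v = n} (μ⇓ below d) (μ⇓ below′ d′) with <-cmp m n
... | tri< m<n _ _ with () ← ⇓-deterministic d (proj₂ (below′ m m<n))
... | tri≈ _ m≡n _ = m≡n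
... | tri> _ _ n<m with () ← ⇓-deterministic (proj₂ (below n n<m)) d′
⇓*-deterministic []       []         = refl
⇓*-deterministic (d ∷ ds) (d′ ∷ ds′) = cong₂ _∷_ (⇓-deterministic d d′) (⇓*-deterministic ds ds′)

Stable : ∀ {o} → Vec Baire o → ℕ → (Vec Baire o → Set) → Set
Stable ρ U P = ∀ {σ} → AgreeVec U ρ σ → P σ

-- A halting derivation is well-founded and finitely branching, so it asks only finitely many oracle
-- questions; a bound is the maximum over the subderivations.
⇓-use : ∀ {o k} {ρ : Vec Baire o} {e : Code o k} {ns v} → ρ ⊢ e · ns ⇓ v →
        ∃[ U ] Stable ρ U (λ σ → σ ⊢ e · ns ⇓ v)
⇓*-use : ∀ {o j k} {ρ : Vec Baire o} {gs : Vec (Code o k) j} {ns vs} →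
         Pointwise (λ g m → ρ ⊢ g · ns ⇓ m) gs vs →
         ∃[ U ] Stable ρ U (λ σ → Pointwise (λ g m → σ ⊢ g · ns ⇓ m) gs vs)
⇓-use zero⇓ = 0 , λ _ → zero⇓
⇓-use suc⇓ = 0 , λ _ → suc⇓
⇓-use proj⇓ = 0 , λ _ → proj⇓
⇓-use {ρ = ρ} (query⇓ {i} {n}) = suc n , λ {σ} a →
  subst (σ ⊢ query i · n ∷ [] ⇓_) (sym (AgreeVec-lookup a i n ≤-refl)) query⇓
⇓-use (comp⇓ ds d) =
  let U , hU = ⇓*-use ds
      V , hV = ⇓-use d
  in U ⊔ V , λ a → comp⇓ (hU (AgreeVec-mono (m≤m⊔n U V) a)) (hV (AgreeVec-mono (m≤n⊔m U V) a))
⇓-use (base⇓ d) = let U , hU = ⇓-use d in U , λ a → base⇓ (hU a)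
⇓-use (step⇓ c d) =
  let U , hU = ⇓-use c
      V , hV = ⇓-use d
  in U ⊔ V , λ a → step⇓ (hU (AgreeVec-mono (m≤m⊔n U V) a)) (hV (AgreeVec-mono (m≤n⊔m U V) a))
⇓-use {ρ = ρ} (μ⇓ {f = f} {ns} {n} below d) =
  let U , hU = ⇓-use d
      -- The premises of `μ⇓` for arguments below `n` form a function, not a list, so their bounds
      -- have to be merged separately.
      V , hV = uniform-bound
                 (λ m V → Stable ρ V (λ σ → ∃[ v ] σ ⊢ f · m ∷ ns ⇓ suc v))
                 (λ U≤V s a → s (AgreeVec-mono U≤V a))
                 n
                 (λ m m<n → let V , hV = ⇓-use (proj₂ (below m m<n)) in V , λ a → _ , hV a)
  in U ⊔ V , λ a → μ⇓ (λ m m<n → hV m m<n (AgreeVec-mono (m≤n⊔m U V) a)) (hU (AgreeVec-mono (m≤m⊔n U V) a))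
⇓*-use [] = 0 , λ _ → []
⇓*-use (d ∷ ds) =
  let U , hU = ⇓-use d
      V , hV = ⇓*-use ds
  in U ⊔ V , λ a → hU (AgreeVec-mono (m≤m⊔n U V) a) ∷ hV (AgreeVec-mono (m≤n⊔m U V) a)

-- The derivations of the first `N` values survive the change of oracle, and determinism identifies
-- their results with the values of `β′`.
continuous : ∀ {o} {e : Code o 1} {ρ β} → e ⟪ ρ ⟫≃ β → ∀ N →
             ∃[ U ] ∀ {σ β′} → AgreeVec U ρ σ → e ⟪ σ ⟫≃ β′ → Agree N β β′
continuous {e = e} {ρ} {β} d N =
  let U , hU = uniform-bound (λ n U → Stable ρ U (λ σ → σ ⊢ e · n ∷ [] ⇓ β n))
                             (λ U≤V s a → s (AgreeVec-mono U≤V a)) N (λ n _ → ⇓-use (d n))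
  in U , λ a d′ n n<N → ⇓-deterministic (hU n n<N a) (d′ n)

-- Computable instances

Computable-tail : ∀ {f} → Computable f → Computable (tail f)
Computable-tail (e , d) = comp e (sucᶜ ∷ []) , λ n → comp⇓ (suc⇓ ∷ []) (d (suc n))

constᶜ : ∀ {o k} → ℕ → Code o k
constᶜ zero    = zeroᶜ
constᶜ (suc a) = comp sucᶜ (constᶜ a ∷ [])

constᶜ-⇓ : ∀ {o k} {ρ : Vec Baire o} {ns : Vec ℕ k} a → ρ ⊢ constᶜ a · ns ⇓ a
constᶜ-⇓ zero    = zero⇓
constᶜ-⇓ (suc a) = comp⇓ (constᶜ-⇓ a ∷ []) suc⇓

Computable-∷ˢ : ∀ a {f} → Computable f → Computable (a ∷ˢ f)
Computable-∷ˢ a {f} (e , d) = primrec (constᶜ a) (comp e (proj zero ∷ [])) , compute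
  where
  compute : primrec (constᶜ a) (comp e (proj zero ∷ [])) ⟪ [] ⟫≃ (a ∷ˢ f)
  compute zero    = base⇓ (constᶜ-⇓ a)
  compute (suc n) = step⇓ (compute n) (comp⇓ (proj⇓ ∷ []) (d n))

-- Prepending one value at a time turns the prefix of `f` into finitely many constants in a program
-- for `g`.
splice : ℕ → Baire → Baire → Baire
splice zero    f g = g
splice (suc L) f g = head f ∷ˢ splice L (tail f) (tail g)

splice-< : ∀ L f g → Agree L (splice L f g) f
splice-< (suc L) f g zero    _         = refl
splice-< (suc L) f g (suc p) (s≤s p<L) = splice-< L (tail f) (tail g) p p<L

splice-≥ : ∀ L f g {p} → L ≤ p → splice L f g p ≡ g p
splice-≥ zero    f g _         = refl
splice-≥ (suc L) f g (s≤s L≤p) = splice-≥ L (tail f) (tail g) L≤p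

splice-≡ : ∀ L f g {p a} → f p ≡ a → g p ≡ a → splice L f g p ≡ a
splice-≡ L f g {p} f≡a g≡a with p <? L
... | yes p<L = trans (splice-< L f g p p<L) f≡a
... | no  p≮L = trans (splice-≥ L f g (≮⇒≥ p≮L)) g≡a

Computable-splice : ∀ L {f g} → Computable g → Computable (splice L f g)
Computable-splice zero    c = c
Computable-splice (suc L) c = Computable-∷ˢ _ (Computable-splice L (Computable-tail c))

decr : ℕ → ℕ → ℕ
decr K zero    = K
decr K (suc r) = r

-- Runs through K, K - 1, ..., 0 cyclically, so its zeros are the p for which K + 1 divides p + 1.
countdown : ℕ → Baire
countdown K zero    = K
countdown K (suc p) = decr K (countdown K p)

Computable-countdown : ∀ K → Computable (countdown K)
Computable-countdown K = primrec (constᶜ K) (comp decrᶜ (proj (suc zero) ∷ [])) , compute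
  where
  decrᶜ : Code 0 1
  decrᶜ = primrec (constᶜ K) (proj zero)

  decr-⇓ : ∀ r → [] ⊢ decrᶜ · r ∷ [] ⇓ decr K r
  decr-⇓ zero    = base⇓ (constᶜ-⇓ K)
  decr-⇓ (suc r) = step⇓ (decr-⇓ r) proj⇓

  compute : ∀ p → [] ⊢ primrec (constᶜ K) (comp decrᶜ (proj (suc zero) ∷ [])) · p ∷ [] ⇓ countdown K p
  compute zero    = base⇓ (constᶜ-⇓ K)
  compute (suc p) = step⇓ (compute p) (comp⇓ (proj⇓ ∷ []) (decr-⇓ _))

-- Doubling the period mirrors the recursion of `pair`: column 0 occupies the even positions, and
-- column n + 1 sits on the odd ones as column n does on all.
countdown-even : ∀ K q → countdown (suc (2 * K)) (2 * q) ≡ suc (2 * countdown K q)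
countdown-odd : ∀ K q → countdown (suc (2 * K)) (suc (2 * q)) ≡ 2 * countdown K q
countdown-odd K q = cong (decr _) (countdown-even K q)
countdown-even K zero    = refl
countdown-even K (suc q) = begin
  countdown (suc (2 * K)) (2 * suc q)            ≡⟨ cong (countdown _) (*-suc 2 q) ⟩
  decr _ (countdown (suc (2 * K)) (suc (2 * q))) ≡⟨ cong (decr _) (countdown-odd K q) ⟩
  decr (suc (2 * K)) (2 * countdown K q)         ≡⟨ decr-double (countdown K q) ⟩
  suc (2 * decr K (countdown K q))               ∎
  where
  open ≡-Reasoning
  decr-double : ∀ r → decr (suc (2 * K)) (2 * r) ≡ suc (2 * decr K r)
  decr-double zero    = refl
  decr-double (suc r) = +-suc r (r + 0)

-- Since pair t 0 = 2ᵗ - 1, this vanishes exactly where 2ᵗ divides p + 1.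
belowColumn : ℕ → Baire
belowColumn t = countdown (pair t 0)

belowColumn-≥ : ∀ {t n} m → t ≤ n → belowColumn t (pair n m) ≡ 0
belowColumn-≥ {n = n} m z≤n = countdown-0 (pair n m)
  where
  countdown-0 : ∀ p → countdown 0 p ≡ 0
  countdown-0 zero    = refl
  countdown-0 (suc p) = cong (decr 0) (countdown-0 p)
belowColumn-≥ {suc t} {suc n} m (s≤s t≤n) =
  trans (countdown-odd (pair t 0) (pair n m)) (cong (2 *_) (belowColumn-≥ m t≤n))

belowColumn-< : ∀ {t n} m → n < t → belowColumn t (pair n m) ≢ 0
belowColumn-< {suc t} {zero}  m _ z with () ← trans (sym (countdown-even (pair t 0) m)) z
belowColumn-< {suc t} {suc n} m (s≤s n<t) z =
  belowColumn-< m n<t (m+n≡0⇒m≡0 _ (trans (sym (countdown-odd (pair t 0) (pair n m))) z))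

-- The pairing function

parity : ∀ p → ∃[ q ] (p ≡ 2 * q ⊎ p ≡ suc (2 * q))
parity zero = 0 , inj₁ refl
parity (suc p) with parity p
... | q , inj₁ even = q , inj₂ (cong suc even)
... | q , inj₂ odd  = suc q , inj₁ (trans (cong suc odd) (sym (*-suc 2 q)))

unpair : ∀ p → ∃[ n ] ∃[ m ] pair n m ≡ p
unpair = <-rec _ step
  where
  step : ∀ p → (∀ {q} → q < p → ∃[ n ] ∃[ m ] pair n m ≡ q) → ∃[ n ] ∃[ m ] pair n m ≡ p
  step p rec with parity p
  ... | q , inj₁ even = 0 , q , sym even
  ... | q , inj₂ refl = let n , m , e = rec (s≤s (m≤m+n q _)) in suc n , m , cong (λ p → suc (2 * p)) e

pair-injective : ∀ n m n′ m′ → pair n m ≡ pair n′ m′ → n ≡ n′ × m ≡ m′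
pair-injective zero    m zero     m′ e = refl , *-cancelˡ-≡ m m′ 2 e
pair-injective zero    m (suc n′) m′ e = contradiction e (even≢odd m (pair n′ m′))
pair-injective (suc n) m zero     m′ e = contradiction (sym e) (even≢odd m′ (pair n m))
pair-injective (suc n) m (suc n′) m′ e =
  let n≡ , m≡ = pair-injective n m n′ m′ (*-cancelˡ-≡ _ _ 2 (suc-injective e)) in cong suc n≡ , m≡

n≤pair : ∀ n m → n ≤ pair n m
n≤pair zero    m = z≤n
n≤pair (suc n) m = s≤s (≤-trans (n≤pair n m) (m≤m+n _ _))

m≤pair : ∀ n m → m ≤ pair n m
m≤pair zero    m = m≤m+n m _
m≤pair (suc n) m = m≤n⇒m≤1+n (≤-trans (m≤pair n m) (m≤m+n _ _))

pair-monoʳ-≤ : ∀ n {m m′} → m ≤ m′ → pair n m ≤ pair n m′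
pair-monoʳ-≤ zero    m≤m′ = *-monoʳ-≤ 2 m≤m′
pair-monoʳ-≤ (suc n) m≤m′ = s≤s (*-monoʳ-≤ 2 (pair-monoʳ-≤ n m≤m′))

join : (ℕ → Baire) → Baire
join A p = let n , m , _ = unpair p in A n m

section-join : ∀ A n → section (join A) n ≗ A n
section-join A n m =
  let _ , _ , e = unpair (pair n m)
      n≡ , m≡   = pair-injective _ _ n m e
  in cong₂ A n≡ m≡

join-agree : ∀ {A B U} → (∀ n m → pair n m < U → A n m ≡ B n m) → Agree U (join A) (join B)
join-agree h p p<U with n , m , refl ← unpair p = h n m p<U

∷ˢ-agree : ∀ a {f g U} → Agree U f g → Agree U (a ∷ˢ f) (a ∷ˢ g)
∷ˢ-agree a h zero    _   = refl
∷ˢ-agree a h (suc p) p<U = h p (<-trans (n<1+n p) p<U)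

-- Witnesses

-- The witness inside column `n`, for `∃′` and `∃∞` alike: the chosen row `j`, then the tuple (n, j,
-- x) demanded at the leaf.
leaf : ℕ → ℕ → Baire → Baire
leaf n j x = j ∷ˢ n ∷ˢ j ∷ˢ x

leaf-agree : ∀ n {j j′ U x x′} → j ≡ j′ → Agree U x x′ → Agree U (leaf n j x) (leaf n j′ x′)
leaf-agree n refl a = ∷ˢ-agree _ (∷ˢ-agree _ (∷ˢ-agree _ a))

LeafWitness : ℕ → Baire → Baire → Set
LeafWitness n x S = tail S ≗ (n ∷ head S ∷ []) ++ˢ x × x (pair n (head S)) ≡ 0

-- The leaf must repeat the instance, so the chosen row determines the whole witness.
leafWitness⇒leaf : ∀ {n x} S → LeafWitness n x S → S ≗ leaf n (head S) x
leafWitness⇒leaf S w zero    = refl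
leafWitness⇒leaf S w (suc p) = proj₁ w p

leaf⇒leafWitness : ∀ {n j x S} → S ≗ leaf n j x → x (pair n j) ≡ 0 → LeafWitness n x S
leaf⇒leafWitness {n} {j} {x} {S} S≗leaf z = tail≗ , trans (cong (x ∘ pair n) (S≗leaf 0)) z
  where
  tail≗ : tail S ≗ (n ∷ head S ∷ []) ++ˢ x
  tail≗ 0             = S≗leaf 1
  tail≗ 1             = trans (S≗leaf 2) (sym (S≗leaf 0))
  tail≗ (suc (suc p)) = S≗leaf (suc (suc (suc p)))

φ ψ : Formula
φ = ⟨ ∀∞ ∷ ∃∞ ∷ [] ⟩
ψ = ⟨ ∀∞ ∷ ∃′ ∷ [] ⟩

φ-witness : ℕ → Baire → (ℕ → ℕ → ℕ) → Baire
φ-witness t x J = t ∷ˢ join (λ n → join (λ k → leaf n (J n k) x))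

φ-witness-⊩ : ∀ t x J → (∀ n → t ≤ n → ∀ k → k ≤ J n k × x (pair n (J n k)) ≡ 0) →
              φ-witness t x J ⊩ φ at x
φ-witness-⊩ t x J h n t≤n k =
  let k≤J , z = h n t≤n k
  in ≤-trans k≤J (≤-reflexive (sym (S≗leaf 0))) , leaf⇒leafWitness S≗leaf z
  where
  S≗leaf : section (section (tail (φ-witness t x J)) n) k ≗ leaf n (J n k) x
  S≗leaf p = trans
    (section-join (λ n → join (λ k → leaf n (J n k) x)) n (pair k p))
    (section-join (λ k → leaf n (J n k) x) k p)

-- The inner entry at `pair n (pair k l)` depends only on `J n k` and on values of the instance
-- below `l`, and `pair` is large enough to keep both under the bound.
φ-witness-agree : ∀ t {x x′} J J′ {U} → Agree U x x′ → (∀ n k → pair n k < U → J n k ≡ J′ n k) →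
                  Agree U (φ-witness t x J) (φ-witness t x′ J′)
φ-witness-agree t {x} {x′} J J′ {U} a h = ∷ˢ-agree t (join-agree agree)
  where
  agree : ∀ n q → pair n q < U → join (λ k → leaf n (J n k) x) q ≡ join (λ k → leaf n (J′ n k) x′) q
  agree n q nq<U with k , l , refl ← unpair q =
    leaf-agree n
      (h n k (≤-<-trans (pair-monoʳ-≤ n (n≤pair k l)) nq<U)) a l
      (≤-<-trans (≤-trans (m≤pair k l) (m≤pair n _)) nq<U)

-- The next zero of a column is found at k itself when the entry there is zero.  Jumping
-- past U only otherwise keeps the resulting φ-witness close to that of the zero sequence.
jump : ℕ → ℕ → ℕ → ℕ
jump U zero    k = k
jump U (suc _) k = k + U

jump-valid : ∀ U (x : Baire) → (∀ {p} → U ≤ p → x p ≡ 0) → ∀ n k →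
             let j = jump U (x (pair n k)) k in k ≤ j × x (pair n j) ≡ 0
jump-valid U x x≡0 n k with x (pair n k) in eq
... | zero  = ≤-refl , eq
... | suc _ = m≤m+n k U , x≡0 (≤-trans (m≤n+m U k) (m≤pair n _))

-- A small enough perturbation of the instance may keep the starting point head β of a
-- ψ-witness β: the finitely many zeros not supplied by β′ are already present.
ψ-witness-transfer :
  ∀ β {y} → β ⊩ ψ at y → ∀ P s →
  ∃[ V ] ∀ β′ {y′} → Agree V y y′ → β′ ⊩ ψ at y′ → head β′ ≤ s →
  ∃[ γ ] γ ⊩ ψ at y′ × Agree P β γ
ψ-witness-transfer β {y} w P s = V , transfer
  where
  k : ℕ → ℕ
  k n = head (section (tail β) n)

  -- `β′` may say nothing about n below `s`; n below `P` are included so that the prefix of length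
  -- `P` only shows choices of `β`.
  zeros : ∃[ V ] ∀ n → n < s ⊔ P → pair n (k n) < V
  zeros = uniform-bound (λ n V → pair n (k n) < V) (λ U≤V h → <-≤-trans h U≤V) (s ⊔ P)
                        (λ n _ → suc (pair n (k n)) , ≤-refl)

  V : ℕ
  V = P ⊔ proj₁ zeros

  transfer : ∀ β′ {y′} → Agree V y y′ → β′ ⊩ ψ at y′ → head β′ ≤ s →
             ∃[ γ ] γ ⊩ ψ at y′ × Agree P β γ
  transfer β′ {y′} a w′ t≤s = head β ∷ˢ join S , S-⊩ , S-agree
    where
    S : ℕ → Baire
    -- Below `head β` nothing is demanded, and copying preserves agreement. In the middle range the
    -- choice of `β` is kept, but its leaf must record `y′`.
    S n with n <? head β | n <? s ⊔ P
    ... | yes _ | _     = section (tail β) n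
    ... | no _  | yes _ = leaf n (k n) y′
    ... | no _  | no _  = section (tail β′) n

    S-leaf : ∀ n → head β ≤ n → LeafWitness n y′ (S n)
    S-leaf n h≤n with n <? head β | n <? s ⊔ P
    ... | yes n<h | _       = contradiction h≤n (<⇒≱ n<h)
    ... | no _    | yes n<B = leaf⇒leafWitness (λ _ → refl)
      (trans (sym (a _ (<-≤-trans (proj₂ zeros n n<B) (m≤n⊔m P _)))) (proj₂ (w n h≤n)))
    ... | no _    | no n≮B  = w′ n (≤-trans t≤s (≤-trans (m≤m⊔n s P) (≮⇒≥ n≮B)))

    S-⊩ : (head β ∷ˢ join S) ⊩ ψ at y′
    S-⊩ n h≤n =
      let wₙ = S-leaf n h≤n
      in leaf⇒leafWitness (λ p → trans (section-join S n p) (leafWitness⇒leaf (S n) wₙ p)) (proj₂ wₙ)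

    section-agree : ∀ n m → pair n m < P → section (tail β) n m ≡ S n m
    section-agree n m nm<P with n <? head β | n <? s ⊔ P
    ... | yes _  | _      = refl
    ... | no n≮h | yes _  = trans (leafWitness⇒leaf (section (tail β) n) (w n (≮⇒≥ n≮h)) m)
      (leaf-agree n refl (Agree-mono (m≤m⊔n P _) a) m (≤-<-trans (m≤pair n m) nm<P))
    ... | no _   | no n≮B = contradiction
      (<-≤-trans (≤-<-trans (n≤pair n m) nm<P) (m≤n⊔m s P)) n≮B

    S-agree : Agree P β (head β ∷ˢ join S)
    S-agree zero    _     = refl
    S-agree (suc p) p+1<P with n , m , refl ← unpair p = section-agree n m (<-trans (n<1+n _) p+1<P)

-- Contradiction from a reduction, through four instances

module _ (R : φ ≤ₘ ψ) where
  open _≤ₘ_ R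

  image : ∀ {x} → Computable x → Baire
  image c = proj₁ (reduces _ c)

  image-η : ∀ {x} (c : Computable x) → η ⟪ x ∷ [] ⟫≃ image c
  image-η c = proj₁ (proj₂ (reduces _ c))

  push : ∀ {x} (c : Computable x) α → α ⊩ φ at x →
         ∃[ β ] r₋ ⟪ α ∷ x ∷ [] ⟫≃ β × β ⊩ ψ at image c
  push c α w = proj₁ (proj₂ (proj₂ (proj₂ (reduces _ c)))) α w

  pull : ∀ {x} (c : Computable x) β → β ⊩ ψ at image c →
         ∃[ γ ] r₊ ⟪ β ∷ x ∷ [] ⟫≃ γ × γ ⊩ φ at x
  pull c β w = proj₂ (proj₂ (proj₂ (proj₂ (reduces _ c)))) β w

  irreducible : ⊥
  irreducible = column-t₀-infinite
    where
    x₀ : Baire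
    x₀ _ = 0

    c₀ : Computable x₀
    c₀ = zeroᶜ , λ _ → zero⇓

    J : ℕ → ℕ → ℕ
    J _ k = k

    α₀ : Baire
    α₀ = φ-witness 0 x₀ J

    push₀ : ∃[ β ] r₋ ⟪ α₀ ∷ x₀ ∷ [] ⟫≃ β × β ⊩ ψ at image c₀
    push₀ = push c₀ α₀ (φ-witness-⊩ 0 x₀ J λ _ _ _ → ≤-refl , refl)

    β₀ : Baire
    β₀ = proj₁ push₀

    pull₀ : ∃[ γ ] r₊ ⟪ β₀ ∷ x₀ ∷ [] ⟫≃ γ × γ ⊩ φ at x₀
    pull₀ = pull c₀ β₀ (proj₂ (proj₂ push₀))

    t₀ : ℕ
    t₀ = head (proj₁ pull₀)

    use-r₊ : ∃[ U ] ∀ {σ γ} → AgreeVec U (β₀ ∷ x₀ ∷ []) σ → r₊ ⟪ σ ⟫≃ γ → Agree 1 (proj₁ pull₀) γ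
    use-r₊ = continuous (proj₁ (proj₂ pull₀)) 1

    P : ℕ
    -- Being positive, `P` covers the head, so `β₂` will start at the same number as `β₀`.
    P = suc (proj₁ use-r₊)

    use-r₋₀ : ∃[ U ] ∀ {σ β} → AgreeVec U (α₀ ∷ x₀ ∷ []) σ → r₋ ⟪ σ ⟫≃ β → Agree P β₀ β
    use-r₋₀ = continuous (proj₁ (proj₂ push₀)) P

    L : ℕ
    -- One length for both functionals: it covers what `r₊` reads of `x₀` and what `r₋` reads of
    -- `α₀` and `x₀`.
    L = P ⊔ proj₁ use-r₋₀

    x₁ z : Baire
    -- The successor makes column `t₀` itself one of the columns without zeros.
    z  = belowColumn (suc t₀)
    x₁ = splice L x₀ z

    c₁ : Computable x₁
    c₁ = Computable-splice L (Computable-countdown _)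

    x₁-zero : ∀ {n} m → t₀ < n → x₁ (pair n m) ≡ 0
    x₁-zero m t₀<n = splice-≡ L x₀ z refl (belowColumn-≥ m t₀<n)

    α₁ : Baire
    α₁ = φ-witness (suc t₀) x₁ J

    push₁ : ∃[ β ] r₋ ⟪ α₁ ∷ x₁ ∷ [] ⟫≃ β × β ⊩ ψ at image c₁
    push₁ = push c₁ α₁ (φ-witness-⊩ (suc t₀) x₁ J λ n t₀<n k → ≤-refl , x₁-zero k t₀<n)

    s₁ : ℕ
    s₁ = head (proj₁ push₁)

    use-r₋₁ : ∃[ U ] ∀ {σ β} → AgreeVec U (α₁ ∷ x₁ ∷ []) σ → r₋ ⟪ σ ⟫≃ β → Agree 1 (proj₁ push₁) β
    use-r₋₁ = continuous (proj₁ (proj₂ push₁)) 1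

    U : ℕ
    U = L ⊔ proj₁ use-r₋₁

    x₂ : Baire
    x₂ = splice U x₁ x₀

    c₂ : Computable x₂
    c₂ = Computable-splice U c₀

    x₂-agree : Agree L x₀ x₂
    x₂-agree = Agree-sym (Agree-trans (Agree-mono (m≤m⊔n L _) (splice-< U x₁ x₀)) (splice-< L x₀ z))

    J₂ : ℕ → ℕ → ℕ
    J₂ n k = jump U (x₂ (pair n k)) k

    α₂ : Baire
    α₂ = φ-witness 0 x₂ J₂

    α₂-agree : Agree L α₀ α₂
    -- Where `x₂` agrees with `x₀` its entry is 0, so `jump` stays at `k`, the choice made by `J`.
    α₂-agree = φ-witness-agree 0 J J₂ x₂-agree λ n k nk<L → cong (λ a → jump U a k) (x₂-agree (pair n k) nk<L)

    push₂ : ∃[ β ] r₋ ⟪ α₂ ∷ x₂ ∷ [] ⟫≃ β × β ⊩ ψ at image c₂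
    push₂ = push c₂ α₂ (φ-witness-⊩ 0 x₂ J₂ λ n _ → jump-valid U x₂ (splice-≥ U x₁ x₀) n)

    β₂ y₂ : Baire
    β₂ = proj₁ push₂
    y₂ = image c₂

    β₂-agree : Agree P β₀ β₂
    β₂-agree = proj₂ use-r₋₀
      (Agree-mono (m≤n⊔m P _) α₂-agree ∷ Agree-mono (m≤n⊔m P _) x₂-agree ∷ []) (proj₁ (proj₂ push₂))

    transfer : ∃[ V ] ∀ β′ {y′} → Agree V y₂ y′ → β′ ⊩ ψ at y′ → head β′ ≤ s₁ →
               ∃[ γ ] γ ⊩ ψ at y′ × Agree P β₂ γ
    -- The resulting `V` depends on `β₂`, `P` and `s₁` alone, so `x₃` can be chosen after it.
    transfer = ψ-witness-transfer β₂ (proj₂ (proj₂ push₂)) P s₁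

    V : ℕ
    V = proj₁ transfer

    use-η : ∃[ W ] ∀ {σ y} → AgreeVec W (x₂ ∷ []) σ → η ⟪ σ ⟫≃ y → Agree V y₂ y
    use-η = continuous (image-η c₂) V

    W : ℕ
    -- `U` preserves the computation of `s₁`, the other term the first `V` values of `y₂`.
    W = U ⊔ proj₁ use-η

    x₃ : Baire
    x₃ = splice W x₂ z

    c₃ : Computable x₃
    c₃ = Computable-splice W (Computable-countdown _)

    x₃-zero : ∀ {n} m → t₀ < n → x₃ (pair n m) ≡ 0
    x₃-zero m t₀<n = splice-≡ W x₂ z (splice-≡ U x₁ x₀ (x₁-zero m t₀<n) refl) (belowColumn-≥ m t₀<n)

    x₃-agree₂ : Agree W x₂ x₃
    x₃-agree₂ = Agree-sym (splice-< W x₂ z)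

    x₃-agree₁ : Agree U x₁ x₃
    x₃-agree₁ = Agree-trans (Agree-sym (splice-< U x₁ x₀)) (Agree-mono (m≤m⊔n U _) x₃-agree₂)

    x₃-agree₀ : Agree L x₀ x₃
    x₃-agree₀ = Agree-trans x₂-agree (Agree-mono (≤-trans (m≤m⊔n L _) (m≤m⊔n U _)) x₃-agree₂)

    push₃ : ∃[ β ] r₋ ⟪ φ-witness (suc t₀) x₃ J ∷ x₃ ∷ [] ⟫≃ β × β ⊩ ψ at image c₃
    push₃ = push c₃ (φ-witness (suc t₀) x₃ J) (φ-witness-⊩ (suc t₀) x₃ J λ n t₀<n k → ≤-refl , x₃-zero k t₀<n)

    y₃ : Baire
    y₃ = image c₃

    y₃-agree : Agree V y₂ y₃
    y₃-agree = proj₂ use-η (Agree-mono (m≤n⊔m U _) x₃-agree₂ ∷ []) (image-η c₃)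

    s₁≡ : s₁ ≡ head (proj₁ push₃)
    s₁≡ = proj₂ use-r₋₁
      (Agree-mono (m≤n⊔m L _) (φ-witness-agree (suc t₀) J J x₃-agree₁ (λ _ _ _ → refl)) ∷
       Agree-mono (m≤n⊔m L _) x₃-agree₁ ∷ [])
      (proj₁ (proj₂ push₃)) 0 ≤-refl

    transfer₃ : ∃[ β ] β ⊩ ψ at y₃ × Agree P β₂ β
    transfer₃ = proj₂ transfer (proj₁ push₃) y₃-agree (proj₂ (proj₂ push₃)) (≤-reflexive (sym s₁≡))

    β₃ : Baire
    β₃ = proj₁ transfer₃

    pull₃ : ∃[ γ ] r₊ ⟪ β₃ ∷ x₃ ∷ [] ⟫≃ γ × γ ⊩ φ at x₃
    pull₃ = pull c₃ β₃ (proj₁ (proj₂ transfer₃))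

    t₀≡ : t₀ ≡ head (proj₁ pull₃)
    t₀≡ = proj₂ use-r₊
      (Agree-mono (n≤1+n _) (Agree-trans β₂-agree (proj₂ (proj₂ transfer₃))) ∷
       Agree-mono (≤-trans (n≤1+n _) (m≤m⊔n P (proj₁ use-r₋₀))) x₃-agree₀ ∷ [])
      (proj₁ (proj₂ pull₃)) 0 ≤-refl

    column-t₀-infinite : ⊥
    column-t₀-infinite =
      -- Asking for a zero of column `t₀` at a row beyond `W` leads to a position where `x₃` is
      -- already `z`.
      let W≤j , _ , x₃≡0 = proj₂ (proj₂ pull₃) t₀ (≤-reflexive (sym t₀≡)) W
      in belowColumn-< {suc t₀} {t₀} _ ≤-refl (trans (sym (splice-≥ W x₂ z (≤-trans W≤j (m≤pair t₀ _)))) x₃≡0)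

theorem4p12 : ¬ (⟨ ∀∞ ∷ ∃∞ ∷ [] ⟩ ≤ₘ ⟨ ∀∞ ∷ ∃′ ∷ [] ⟩)
theorem4p12 = irreducible
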